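{- Let H1 $=i(x,i(y,x))$, H2 $=i(i(x,i(y,z)),i(i(x,y),i(x,z)))$, H3 $=i(i(x,n(x)),n(x))$, H4 $=i(x,i(n(x),y))$. The formulas provable from H1–H4 using condensed detachment as the sole rule of inference are exactly those provable from H1–H4 using modus ponens and substitution. Moreover, if $b$ has a proof by modus ponens from substitution instances of H1–H4 in which no line contains a double negation, then $b$ has a double-negation-free condensed-detachment proof from H1–H4.
   Context: Formulas are terms built from propositional variables using the binary connective $i$ (implication) and the unary connective $n$ (negation). Modus ponens: from $i(p,q)$ and $p$ infer $q$; substitution: from $p$ infer $p\sigma$. Condensed detachment: from a major premiss $i(A,B)$ and a minor premiss $C$, after renaming variables so that the two premisses share no variables, if $A$ and $C$ are unifiable with most general unifier $\sigma$, infer $B\sigma$; alphabetic variants of axioms count as axioms and conclusions may be renamed. A formula contains a double negation if it has a (not necessarily proper) subformula of the form $n(n(t))$; a condensed-detachment proof is double-negation free if none of its deduced (non-axiom) steps contains a double negation. -}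

module Defs where

open import Data.List using (List; []; _∷_; _++_)
open import Data.List.Relation.Unary.All using (All)
open import Data.Nat using (ℕ)
open import Data.Product using (Σ; ∃; _×_)
open import Level using (0ℓ)
open import Relation.Binary.PropositionalEquality using (_≡_)
open import Relation.Nullary using (¬_)
open import Relation.Unary using (Pred)

infixr 20 _⇒_
infix  25 ∼_
infixl 30 _[_]
infix  10 _⊑_ _occursIn_ _≅_

-- p ⇒ q is i(p,q) and ∼ p is n(p).
data Formula : Set where
  var : ℕ → Formula
  _⇒_ : Formula → Formula → Formula
  ∼_  : Formula → Formula

Subst : Set
Subst = ℕ → Formula

_[_] : Formula → Subst → Formula
var x   [ σ ] = σ x
(p ⇒ q) [ σ ] = p [ σ ] ⇒ q [ σ ]
(∼ p)   [ σ ] = ∼ (p [ σ ])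

data _⊑_ (s : Formula) : Formula → Set where
  here  : s ⊑ s
  left  : ∀ {p q} → s ⊑ p → s ⊑ p ⇒ q
  right : ∀ {p q} → s ⊑ q → s ⊑ p ⇒ q
  under : ∀ {p} → s ⊑ p → s ⊑ ∼ p

_occursIn_ : ℕ → Formula → Set
x occursIn p = var x ⊑ p

ContainsDN : Formula → Set
ContainsDN p = ∃ λ t → ∼ ∼ t ⊑ p

-- Alphabetic variants: the renaming need only be injective on the
-- variables that actually occur in p.
_≅_ : Formula → Formula → Set
p ≅ q = Σ (ℕ → ℕ) λ ρ →
  (∀ x y → x occursIn p → y occursIn p → ρ x ≡ ρ y → x ≡ y)
  × q ≡ p [ (λ x → var (ρ x)) ]

NoSharedVars : Formula → Formula → Set
NoSharedVars p q = ∀ x → x occursIn p → ¬ (x occursIn q)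

Unifies : Subst → Formula → Formula → Set
Unifies σ p q = p [ σ ] ≡ q [ σ ]

-- The factorisation τ = δ ∘ σ is required at every variable, not only at those
-- of p and q: in condensed detachment σ is also applied to variables of the
-- consequent B that occur in neither unified formula.
IsMGU : Subst → Formula → Formula → Set
IsMGU σ p q =
  Unifies σ p q
  × (∀ τ → Unifies τ p q → Σ Subst λ δ → ∀ x → τ x ≡ σ x [ δ ])

-- CondensedDetachment major minor r: the premisses are renamed apart to A ⇒ B
-- and C, and r is any alphabetic variant of B [ σ ].
data CondensedDetachment (major minor r : Formula) : Set where
  cd : ∀ {A B C} (σ : Subst) →
       major ≅ A ⇒ B →
       minor ≅ C →
       NoSharedVars (A ⇒ B) C →
       IsMGU σ A C →
       B [ σ ] ≅ r →
       CondensedDetachment major minor r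

data CDProof (Ax : Pred Formula 0ℓ) : Formula → Set where
  axiom  : ∀ {p q} → Ax p → p ≅ q → CDProof Ax q
  detach : ∀ {major minor r} →
           CDProof Ax major → CDProof Ax minor →
           CondensedDetachment major minor r → CDProof Ax r

deducedSteps : ∀ {Ax p} → CDProof Ax p → List Formula
deducedSteps (axiom _ _)            = []
deducedSteps (detach {r = r} d e _) = r ∷ deducedSteps d ++ deducedSteps e

DNFree : ∀ {Ax p} → CDProof Ax p → Set
DNFree d = All (λ p → ¬ ContainsDN p) (deducedSteps d)

data MPSubstProof (Ax : Pred Formula 0ℓ) : Formula → Set where
  axiom : ∀ {p} → Ax p → MPSubstProof Ax p
  mp    : ∀ {p q} → MPSubstProof Ax (p ⇒ q) → MPSubstProof Ax p → MPSubstProof Ax q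
  subst : ∀ {p} (σ : Subst) → MPSubstProof Ax p → MPSubstProof Ax (p [ σ ])

-- Substitution is confined to the axioms; modus ponens is the only rule.
data MPProof (Ax : Pred Formula 0ℓ) : Formula → Set where
  instanceOf : ∀ {p} → Ax p → (σ : Subst) → MPProof Ax (p [ σ ])
  mp         : ∀ {p q} → MPProof Ax (p ⇒ q) → MPProof Ax p → MPProof Ax q

-- Every line, including the instances of axioms.
lines : ∀ {Ax p} → MPProof Ax p → List Formula
lines (instanceOf {p} _ σ) = p [ σ ] ∷ []
lines (mp {q = q} d e)     = q ∷ lines d ++ lines e

private
  x y z : Formula
  x = var 0
  y = var 1
  z = var 2

data H : Pred Formula 0ℓ where
  H1 : H (x ⇒ (y ⇒ x))
  H2 : H ((x ⇒ (y ⇒ z)) ⇒ ((x ⇒ y) ⇒ (x ⇒ z)))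
  H3 : H ((x ⇒ ∼ x) ⇒ ∼ x)
  H4 : H (x ⇒ (∼ x ⇒ y))

{-# OPTIONS --safe #-}
module Submission where

-- A condensed-detachment proof is a combinator built from the axioms by
-- application, and the formula it proves is the principal type of that
-- combinator: every typing of the combinator by modus ponens from axiom
-- instances is an instance of it.  For each formula b there is a combinator
-- `ident b` whose typings are exactly the instances of b ⇒ b, namely
-- λ a. K a (junk), where the discarded junk is only typable if a has the shape
-- of b; it uses H1 and H2 for bracket abstraction and H4 to detect negations.
-- If s is the combinator of a modus ponens proof of b, then ident b applied to
-- s has principal type b.  Each deduced step of the condensed-detachment proof
-- is more general than a line of the modus ponens typing, so double negations
-- cannot appear in the former without appearing in the latter.

open import Data.Bool using (Bool; true; false; not; _∨_)
open import Data.Empty using (⊥-elim)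
open import Data.Fin using (Fin; zero; suc)
open import Data.List using (List; []; _∷_; _++_)
open import Data.List.Membership.Propositional using (_∈_)
open import Data.List.Membership.Propositional.Properties using (∈-++⁺ˡ; ∈-++⁺ʳ)
open import Data.List.Relation.Unary.All using (All; []; _∷_)
open import Data.List.Relation.Unary.All.Properties using (++⁺; ++⁻ˡ; ++⁻ʳ)
open import Data.List.Relation.Unary.Any using (here; there)
open import Data.Nat using (ℕ; zero; suc; _+_; _≤_; s≤s; _≟_)
open import Data.Nat.Properties using (≤-refl; ≤-trans; m≤m+n; m≤n+m; m≤n⇒m≤1+n; 1+n≰n; suc-injective)
open import Data.Product using (Σ; _×_; _,_; proj₁; proj₂; ∃)
open import Data.Sum using (_⊎_; inj₁; inj₂)
open import Data.Unit using (tt)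
open import Data.Vec.Functional using (Vector) renaming ([] to ∅; _∷_ to _▹_)
open import Function using (_∘_; const)
open import Function.Bundles using (_⇔_; mk⇔)
open import Level using (0ℓ)
open import Relation.Binary.PropositionalEquality using (_≡_; _≢_; refl; sym; trans; cong; cong₂) renaming (subst to ≡-subst)
open import Relation.Nullary using (¬_; yes; no)
open import Relation.Unary using (Pred; U)
open import Defs

-- Substitutions

infixl 30 _⨟_

_⨟_ : Subst → Subst → Subst
(σ ⨟ τ) x = σ x [ τ ]

rename : (ℕ → ℕ) → Subst
rename ρ x = var (ρ x)

⇒-injective : ∀ {p q r s} → p ⇒ q ≡ r ⇒ s → p ≡ r × q ≡ s
⇒-injective refl = refl , refl

∼-injective : ∀ {p q} → ∼ p ≡ ∼ q → p ≡ q
∼-injective refl = refl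

var-injective : ∀ {x y} → var x ≡ var y → x ≡ y
var-injective refl = refl

[]-cong : ∀ p {σ τ} → (∀ x → x occursIn p → σ x ≡ τ x) → p [ σ ] ≡ p [ τ ]
[]-cong (var x) e = e x here
[]-cong (p ⇒ q) e = cong₂ _⇒_ ([]-cong p λ x o → e x (left o)) ([]-cong q λ x o → e x (right o))
[]-cong (∼ p)   e = cong ∼_ ([]-cong p λ x o → e x (under o))

[]-injective : ∀ p {σ τ} → p [ σ ] ≡ p [ τ ] → ∀ x → x occursIn p → σ x ≡ τ x
[]-injective (var x) e _ here      = e
[]-injective (p ⇒ q) e x (left o)  = []-injective p (proj₁ (⇒-injective e)) x o
[]-injective (p ⇒ q) e x (right o) = []-injective q (proj₂ (⇒-injective e)) x o
[]-injective (∼ p)   e x (under o) = []-injective p (∼-injective e) x o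

[]-var : ∀ p → p [ var ] ≡ p
[]-var (var x) = refl
[]-var (p ⇒ q) = cong₂ _⇒_ ([]-var p) ([]-var q)
[]-var (∼ p)   = cong ∼_ ([]-var p)

[]-⨟ : ∀ p σ τ → p [ σ ] [ τ ] ≡ p [ σ ⨟ τ ]
[]-⨟ (var x) σ τ = refl
[]-⨟ (p ⇒ q) σ τ = cong₂ _⇒_ ([]-⨟ p σ τ) ([]-⨟ q σ τ)
[]-⨟ (∼ p)   σ τ = cong ∼_ ([]-⨟ p σ τ)

[]-absorb : ∀ p {σ τ} → (∀ x → σ x [ τ ] ≡ τ x) → p [ σ ] [ τ ] ≡ p [ τ ]
[]-absorb p {σ} {τ} e = trans ([]-⨟ p σ τ) ([]-cong p λ x _ → e x)

⊑-[] : ∀ {s p} σ → s ⊑ p → s [ σ ] ⊑ p [ σ ]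
⊑-[] σ here      = here
⊑-[] σ (left o)  = left (⊑-[] σ o)
⊑-[] σ (right o) = right (⊑-[] σ o)
⊑-[] σ (under o) = under (⊑-[] σ o)

occursIn-rename : ∀ p {ρ x} → x occursIn (p [ rename ρ ]) → ∃ λ y → x ≡ ρ y
occursIn-rename (var y) here      = y , refl
occursIn-rename (p ⇒ q) (left o)  = occursIn-rename p o
occursIn-rename (p ⇒ q) (right o) = occursIn-rename q o
occursIn-rename (∼ p)   (under o) = occursIn-rename p o

size : Formula → ℕ
size (var _) = 1
size (p ⇒ q) = suc (size p + size q)
size (∼ p)   = suc (size p)

⊑⇒size≤ : ∀ {s p} → s ⊑ p → size s ≤ size p
⊑⇒size≤ here      = ≤-refl
⊑⇒size≤ (left o)  = m≤n⇒m≤1+n (≤-trans (⊑⇒size≤ o) (m≤m+n _ _))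
⊑⇒size≤ (right o) = m≤n⇒m≤1+n (≤-trans (⊑⇒size≤ o) (m≤n+m _ _))
⊑⇒size≤ (under o) = m≤n⇒m≤1+n (⊑⇒size≤ o)

-- Alphabetic variants

≅-refl : ∀ {p} → p ≅ p
≅-refl {p} = (λ x → x) , (λ _ _ _ _ e → e) , sym ([]-var p)

≅-trans : ∀ {p q r} → p ≅ q → q ≅ r → p ≅ r
≅-trans {p} (ρ , ρ-inj , refl) (π , π-inj , refl) =
  π ∘ ρ ,
  (λ x y ox oy e → ρ-inj x y ox oy (π-inj (ρ x) (ρ y) (⊑-[] (rename ρ) ox) (⊑-[] (rename ρ) oy) e)) ,
  []-⨟ p (rename ρ) (rename π)

≅-rename : ∀ {p ρ} → (∀ {x y} → ρ x ≡ ρ y → x ≡ y) → p ≅ p [ rename ρ ]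
≅-rename {ρ = ρ} inj = ρ , (λ _ _ _ _ → inj) , refl

varName : Formula → ℕ
varName (var x) = x
varName _       = 0

[]≡var : ∀ p {τ x} → p [ τ ] ≡ var x → p ≡ var (varName p)
[]≡var (var _) _ = refl

-- `τ` undoes `σ` on the variables of `p`, so `σ` sends these variables to variables, and does so
-- injectively.
instances⇒≅ : ∀ {p q} σ τ → q ≡ p [ σ ] → p ≡ q [ τ ] → p ≅ q
instances⇒≅ {p} σ τ refl e = varName ∘ σ , inj , []-cong p σ-var
  where
  back : ∀ x → x occursIn p → σ x [ τ ] ≡ var x
  back = []-injective p (trans (sym ([]-⨟ p σ τ)) (trans (sym e) (sym ([]-var p))))

  σ-var : ∀ x → x occursIn p → σ x ≡ rename (varName ∘ σ) x
  σ-var x o = []≡var (σ x) (back x o)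

  inj : ∀ x y → x occursIn p → y occursIn p → varName (σ x) ≡ varName (σ y) → x ≡ y
  inj x y ox oy eq = var-injective (trans (sym (back x ox)) (trans (cong _[ τ ] σx≡σy) (back y oy)))
    where
    σx≡σy : σ x ≡ σ y
    σx≡σy = trans (σ-var x ox) (trans (cong var eq) (sym (σ-var y oy)))

-- Unification

-- Each unifier `τ` factors through the most general one with `τ` itself as second factor. This form
-- of idempotence lets `unify` keep one and the same `τ` throughout its recursion.
record IdempotentMGU (p q : Formula) : Set where
  constructor mgu
  field
    unifier : Subst
    unifies : Unifies unifier p q
    absorbs : ∀ τ → Unifies τ p q → ∀ x → unifier x [ τ ] ≡ τ x

  isMGU : IsMGU unifier p q
  isMGU = unifies , λ τ e → τ , λ x → sym (absorbs τ e x)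

open IdempotentMGU

mgu-sym : ∀ {p q} → IdempotentMGU p q → IdempotentMGU q p
mgu-sym (mgu σ u a) = mgu σ (sym u) (λ τ e → a τ (sym e))

mgu-refl : ∀ {p} → IdempotentMGU p p
mgu-refl = mgu var refl (λ _ _ _ → refl)

_↦_ : ℕ → Formula → Subst
(x ↦ p) y with x ≟ y
... | yes _ = p
... | no _  = var y

↦-same : ∀ x p → (x ↦ p) x ≡ p
↦-same x p with x ≟ x
... | yes _  = refl
... | no x≢x = ⊥-elim (x≢x refl)

↦-other : ∀ {x y} p → x ≢ y → (x ↦ p) y ≡ var y
↦-other {x} {y} p x≢y with x ≟ y
... | yes x≡y = ⊥-elim (x≢y x≡y)
... | no _    = refl

↦-absorbs : ∀ {x p} τ → τ x ≡ p [ τ ] → ∀ y → (x ↦ p) y [ τ ] ≡ τ y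
↦-absorbs {x} τ e y with x ≟ y
... | yes refl = sym e
... | no _     = refl

eliminate : ∀ x p → ¬ (x occursIn p) → IdempotentMGU (var x) p
eliminate x p x∉p = mgu (x ↦ p) (trans (↦-same x p) (sym fixed)) ↦-absorbs
  where
  fixed : p [ x ↦ p ] ≡ p
  fixed = trans ([]-cong p λ y o → ↦-other p λ { refl → x∉p o }) ([]-var p)

-- `τ x` is a subformula of `s [ τ ]`, hence too small to equal `p [ τ ]`. Because a unifier is
-- always at hand, elimination of a variable never fails.
occursCheck : ∀ {x p s} τ → x occursIn s → suc (size (s [ τ ])) ≤ size (p [ τ ]) → τ x ≢ p [ τ ]
occursCheck τ o s<p e = 1+n≰n (≤-trans s<p (≡-subst (λ r → size r ≤ _) e (⊑⇒size≤ (⊑-[] τ o))))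

unifyVar : ∀ x p τ → τ x ≡ p [ τ ] → IdempotentMGU (var x) p
unifyVar x (var y) τ e with x ≟ y
... | yes refl = mgu-refl
... | no x≢y   = eliminate x (var y) λ { here → x≢y refl }
unifyVar x p@(q ⇒ r) τ e = eliminate x p λ
  { (left o)  → occursCheck {p = p} τ o (s≤s (m≤m+n _ _)) e
  ; (right o) → occursCheck {p = p} τ o (s≤s (m≤n+m _ _)) e }
unifyVar x p@(∼ q) τ e = eliminate x p λ
  { (under o) → occursCheck {p = p} τ o ≤-refl e }

-- The recursion is on the common instance r: solving the first component of a
-- pair leaves the instance of the second one unchanged.
unify : ∀ r p q τ → p [ τ ] ≡ r → q [ τ ] ≡ r → IdempotentMGU p q
unify r (var x) q τ e f = unifyVar x q τ (trans e (sym f))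
unify r p@(_ ⇒ _) (var y) τ e f = mgu-sym (unifyVar y p τ (trans f (sym e)))
unify r p@(∼ _)   (var y) τ e f = mgu-sym (unifyVar y p τ (trans f (sym e)))
unify (r ⇒ r′) (p ⇒ p′) (q ⇒ q′) τ e f = mgu (σ₁ ⨟ σ₂) unif abs
  where
  e₁ = proj₁ (⇒-injective e)
  e₂ = proj₂ (⇒-injective e)
  f₁ = proj₁ (⇒-injective f)
  f₂ = proj₂ (⇒-injective f)
  m₁ = unify r p q τ e₁ f₁
  σ₁ = unifier m₁

  absorb₁ : ∀ s υ → Unifies υ p q → s [ σ₁ ] [ υ ] ≡ s [ υ ]
  absorb₁ s υ u = []-absorb s (absorbs m₁ υ u)

  m₂ = unify r′ (p′ [ σ₁ ]) (q′ [ σ₁ ]) τ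
         (trans (absorb₁ p′ τ (trans e₁ (sym f₁))) e₂) (trans (absorb₁ q′ τ (trans e₁ (sym f₁))) f₂)
  σ₂ = unifier m₂

  unif : Unifies (σ₁ ⨟ σ₂) (p ⇒ p′) (q ⇒ q′)
  unif = cong₂ _⇒_
    (trans (sym ([]-⨟ p σ₁ σ₂)) (trans (cong _[ σ₂ ] (unifies m₁)) ([]-⨟ q σ₁ σ₂)))
    (trans (sym ([]-⨟ p′ σ₁ σ₂)) (trans (unifies m₂) ([]-⨟ q′ σ₁ σ₂)))

  abs : ∀ υ → Unifies υ (p ⇒ p′) (q ⇒ q′) → ∀ x → (σ₁ ⨟ σ₂) x [ υ ] ≡ υ x
  abs υ u x = trans ([]-absorb (σ₁ x) (absorbs m₂ υ u₂)) (absorbs m₁ υ u₁ x)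
    where
    u₁ = proj₁ (⇒-injective u)
    u₂ = trans (absorb₁ p′ υ u₁) (trans (proj₂ (⇒-injective u)) (sym (absorb₁ q′ υ u₁)))
unify (∼ r) (∼ p) (∼ q) τ e f with unify r p q τ (∼-injective e) (∼-injective f)
... | mgu σ u a = mgu σ (cong ∼_ u) (λ υ e → a υ (∼-injective e))
unify (var _) (_ ⇒ _) (_ ⇒ _) _ () _
unify (var _) (∼ _) (∼ _) _ () _
unify (∼ _) (_ ⇒ _) (_ ⇒ _) _ () _
unify (_ ⇒ _) (∼ _) (∼ _) _ () _
unify _ (_ ⇒ _) (∼ _) _ refl ()
unify _ (∼ _) (_ ⇒ _) _ refl ()

-- Renaming apart

double : ℕ → ℕ
double zero    = zero
double (suc n) = suc (suc (double n))

double-injective : ∀ {m n} → double m ≡ double n → m ≡ n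
double-injective {zero}  {zero}  _ = refl
double-injective {suc m} {suc n} e = cong suc (double-injective (suc-injective (suc-injective e)))

double≢suc-double : ∀ m n → double m ≢ suc (double n)
double≢suc-double (suc m) (suc n) e = double≢suc-double m n (suc-injective (suc-injective e))

-- Merges one substitution per premiss into one for the renamed pair: `σ` acts at even indices and
-- `τ` at odd ones, the two trading places at each successor.
interleave : Subst → Subst → Subst
interleave σ τ zero    = σ zero
interleave σ τ (suc n) = interleave τ (σ ∘ suc) n

interleave-double : ∀ σ τ n → interleave σ τ (double n) ≡ σ n
interleave-double σ τ zero    = refl
interleave-double σ τ (suc n) = interleave-double (σ ∘ suc) (τ ∘ suc) n

interleave-suc-double : ∀ σ τ n → interleave σ τ (suc (double n)) ≡ τ n
interleave-suc-double σ τ n = interleave-double τ (σ ∘ suc) n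

evens odds : Formula → Formula
evens p = p [ rename double ]
odds p  = p [ rename (suc ∘ double) ]

evens-interleave : ∀ p σ τ → evens p [ interleave σ τ ] ≡ p [ σ ]
evens-interleave p σ τ =
  trans ([]-⨟ p _ _) ([]-cong p λ n _ → interleave-double σ τ n)

odds-interleave : ∀ p σ τ → odds p [ interleave σ τ ] ≡ p [ τ ]
odds-interleave p σ τ =
  trans ([]-⨟ p _ _) ([]-cong p λ n _ → interleave-suc-double σ τ n)

evens-odds-apart : ∀ p q → NoSharedVars (evens p) (odds q)
evens-odds-apart p q x o o′ with occursIn-rename p o | occursIn-rename q o′
... | m , refl | n , e = double≢suc-double m n e

-- Combinators and their typings

infixl 25 _·_
infix  5 _∣_⊢_∶_

data Term (n : ℕ) : Set where
  ax  : ∀ {p} → H p → Term n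
  ref : Fin n → Term n
  _·_ : Term n → Term n → Term n

-- `P` is demanded at every node, as it is at every line of a modus ponens proof; the application
-- rule is modus ponens.
data _∣_⊢_∶_ (P : Pred Formula 0ℓ) {n} (Γ : Vector Formula n) : Term n → Formula → Set where
  ax  : ∀ {p q} {h : H p} σ → q ≡ p [ σ ] → P q → P ∣ Γ ⊢ ax h ∶ q
  ref : ∀ {i q} → q ≡ Γ i → P q → P ∣ Γ ⊢ ref i ∶ q
  app : ∀ {p q t u} → P ∣ Γ ⊢ t ∶ p ⇒ q → P ∣ Γ ⊢ u ∶ p → P q → P ∣ Γ ⊢ t · u ∶ q

infix 5 ⊢_∶_

⊢_∶_ : Term 0 → Formula → Set
⊢ t ∶ p = U ∣ ∅ ⊢ t ∶ p

holds : ∀ {P n} {Γ : Vector Formula n} {t p} → P ∣ Γ ⊢ t ∶ p → P p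
holds (ax _ _ Pp)  = Pp
holds (ref _ Pp)   = Pp
holds (app _ _ Pp) = Pp

forget : ∀ {P n} {Γ : Vector Formula n} {t p} → P ∣ Γ ⊢ t ∶ p → U ∣ Γ ⊢ t ∶ p
forget (ax σ e _)  = ax σ e tt
forget (ref e _)   = ref e tt
forget (app d e _) = app (forget d) (forget e) tt

⊢-[] : ∀ {t p} σ → ⊢ t ∶ p → ⊢ t ∶ p [ σ ]
⊢-[] σ (ax {p} τ refl _) = ax (τ ⨟ σ) ([]-⨟ p τ σ) tt
⊢-[] σ (app d e _)       = app (⊢-[] σ d) (⊢-[] σ e) tt

-- The valuation that makes all variables false. Soundness for it shows that no closed term has a
-- variable as its type, so the major premiss of a detachment is never a variable.
truth : Formula → Bool
truth (var _) = false
truth (p ⇒ q) = not (truth p) ∨ truth q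
truth (∼ p)   = not (truth p)

H-true : ∀ {p} → H p → ∀ σ → truth (p [ σ ]) ≡ true
H-true H1 σ with truth (σ 0) | truth (σ 1)
... | true  | true  = refl
... | true  | false = refl
... | false | _     = refl
H-true H2 σ with truth (σ 0) | truth (σ 1) | truth (σ 2)
... | true  | true  | true  = refl
... | true  | true  | false = refl
... | true  | false | _     = refl
... | false | _     | _     = refl
H-true H3 σ with truth (σ 0)
... | true  = refl
... | false = refl
H-true H4 σ with truth (σ 0)
... | true  = refl
... | false = refl

⊢-true : ∀ {t p} → ⊢ t ∶ p → truth p ≡ true
⊢-true (ax {h = h} σ refl _) = H-true h σ
⊢-true (app {p} {q} d e _) with truth p | truth q | ⊢-true d | ⊢-true e
... | true | true | _ | _ = refl

-- `P-gen` carries `P` from a line of a typing to the more general deduced step. Closure under `∼_`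
-- is absent, since freedom from double negations lacks it; this is why `N-intro` asks for
-- `P (∼ p)`.
record Admissible (P : Pred Formula 0ℓ) : Set where
  field
    P-var   : ∀ x → P (var x)
    P-⇒     : ∀ {p q} → P p → P q → P (p ⇒ q)
    P-left  : ∀ {p q} → P (p ⇒ q) → P p
    P-right : ∀ {p q} → P (p ⇒ q) → P q
    P-under : ∀ {p} → P (∼ p) → P p
    P-gen   : ∀ p σ → P (p [ σ ]) → P p

open Admissible

U-admissible : Admissible U
U-admissible = record
  { P-var = _ ; P-⇒ = _ ; P-left = _ ; P-right = _ ; P-under = _ ; P-gen = _ }

DN-free-admissible : Admissible (λ p → ¬ ContainsDN p)
DN-free-admissible = record
  { P-var   = λ { _ (_ , ()) }
  ; P-⇒     = λ { ¬p ¬q (t , left o) → ¬p (t , o) ; ¬p ¬q (t , right o) → ¬q (t , o) }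
  ; P-left  = λ ¬p (t , o) → ¬p (t , left o)
  ; P-right = λ ¬p (t , o) → ¬p (t , right o)
  ; P-under = λ ¬p (t , o) → ¬p (t , under o)
  ; P-gen   = λ p σ ¬p (t , o) → ¬p (t [ σ ] , ⊑-[] σ o)
  }

-- Principal types

StepsSatisfy : ∀ (P : Pred Formula 0ℓ) {p} → CDProof H p → Set
StepsSatisfy P d = All P (deducedSteps d)

-- The renaming is absorbed by the last inference, so no step is added.
CDProof-≅ : ∀ {P p q} (d : CDProof H p) → StepsSatisfy P d → p ≅ q → P q →
            Σ (CDProof H q) (StepsSatisfy P)
CDProof-≅ (axiom h e) _ p≅q _ = axiom h (≅-trans e p≅q) , []
CDProof-≅ (detach d e (cd σ M m apart u c)) (_ ∷ ps) p≅q Pq =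
  detach d e (cd σ M m apart u (≅-trans c p≅q)) , Pq ∷ ps

record Principal (P : Pred Formula 0ℓ) (t : Term 0) : Set where
  field
    type    : Formula
    proof   : CDProof H type
    steps   : StepsSatisfy P proof
    typed   : ⊢ t ∶ type
    general : ∀ {p} → ⊢ t ∶ p → ∃ λ σ → p ≡ type [ σ ]

open Principal

-- Each application becomes one condensed detachment. The given typing supplies a common instance of
-- `A` and `C` renamed apart, so they unify.
principal : ∀ {P t p} → Admissible P → P ∣ ∅ ⊢ t ∶ p → Principal P t
principal _ (ax {p} {h = h} _ _ _) = record
  { type    = p
  ; proof   = axiom h ≅-refl
  ; steps   = []
  ; typed   = ax var (sym ([]-var p)) tt
  ; general = λ { (ax σ e _) → σ , e }
  }
principal {P} adm (app {p} {q} {t} {u} d e Pq) with principal adm d | principal adm e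
... | record { type = var _ ; typed = c } | _ with () ← ⊢-true c
-- No instance of a negation is an implication.
... | record { type = ∼ _ ; general = gen } | _ with () ← proj₂ (gen (forget d))
... | record { type = A ⇒ B ; proof = prf₁ ; steps = st₁ ; typed = ty₁ ; general = gen₁ }
    | record { type = C ; proof = prf₂ ; steps = st₂ ; typed = ty₂ ; general = gen₂ } = record
  { type    = R
  ; proof   = detach prf₁ prf₂
                (cd σ (≅-rename double-injective) (≅-rename (double-injective ∘ suc-injective))
                    (evens-odds-apart (A ⇒ B) C) (isMGU m) ≅-refl)
  ; steps   = P-gen adm R (proj₁ most) (≡-subst P (proj₂ most) Pq) ∷ ++⁺ st₁ st₂
  ; typed   = app (⊢-[] σ (⊢-[] (rename double) ty₁))
                  (≡-subst (⊢ u ∶_) (sym (unifies m)) (⊢-[] σ (⊢-[] (rename (suc ∘ double)) ty₂))) tt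
  ; general = λ { (app d′ e′ _) → factor d′ e′ }
  }
  where
  common : ∀ {p q} → ⊢ t ∶ p ⇒ q → ⊢ u ∶ p →
           ∃ λ υ → (evens A [ υ ] ≡ p × odds C [ υ ] ≡ p) × q ≡ evens B [ υ ]
  common d′ e′ with gen₁ d′ | gen₂ e′
  ... | σ₁ , eq₁ | σ₂ , eq₂ = interleave σ₁ σ₂ ,
    ( trans (evens-interleave A σ₁ σ₂) (sym (proj₁ (⇒-injective eq₁)))
    , trans (odds-interleave C σ₁ σ₂) (sym eq₂)) ,
    trans (proj₂ (⇒-injective eq₁)) (sym (evens-interleave B σ₁ σ₂))

  m : IdempotentMGU (evens A) (odds C)
  m with common (forget d) (forget e)
  ... | υ , (eq₁ , eq₂) , _ = unify p (evens A) (odds C) υ eq₁ eq₂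

  σ = unifier m
  R = evens B [ σ ]

  factor : ∀ {p q} → ⊢ t ∶ p ⇒ q → ⊢ u ∶ p → ∃ λ υ → q ≡ R [ υ ]
  factor d′ e′ with common d′ e′
  ... | υ , (eq₁ , eq₂) , eq =
    υ , trans eq (sym ([]-absorb (evens B) (absorbs m υ (trans eq₁ (sym eq₂)))))

  most = factor (forget d) (forget e)

-- Bracket abstraction

K S N : ∀ {n} → Term n
K = ax H1
S = ax H2
N = ax H4

-- No shortcut such as η is taken: every node of the body survives, so that `ƛ-elim` can recover a
-- typing of the whole body.
ƛ : ∀ {n} → Term (suc n) → Term n
ƛ (ax h)        = K · ax h
ƛ (ref zero)    = S · K · K
ƛ (ref (suc i)) = K · ref i
ƛ (t · u)       = S · ƛ t · ƛ u

⟨_,_,_⟩ : Formula → Formula → Formula → Subst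
⟨ p , q , r ⟩ 0 = p
⟨ p , q , r ⟩ 1 = q
⟨ p , q , r ⟩ _ = r

module _ {P : Pred Formula 0ℓ} (adm : Admissible P) where

  private
    infixr 20 _⇛_
    _⇛_ : ∀ {p q} → P p → P q → P (p ⇒ q)
    _⇛_ = P-⇒ adm

  K-intro : ∀ {n} {Γ : Vector Formula n} {p q} → P p → P q → P ∣ Γ ⊢ K ∶ p ⇒ q ⇒ p
  K-intro {p = p} {q} Pp Pq = ax ⟨ p , q , q ⟩ refl (Pp ⇛ Pq ⇛ Pp)

  S-intro : ∀ {n} {Γ : Vector Formula n} {p q r} → P p → P q → P r →
            P ∣ Γ ⊢ S ∶ (p ⇒ q ⇒ r) ⇒ (p ⇒ q) ⇒ p ⇒ r
  S-intro {p = p} {q} {r} Pp Pq Pr =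
    ax ⟨ p , q , r ⟩ refl ((Pp ⇛ Pq ⇛ Pr) ⇛ (Pp ⇛ Pq) ⇛ Pp ⇛ Pr)

  N-intro : ∀ {n} {Γ : Vector Formula n} {p q} → P (∼ p) → P q → P ∣ Γ ⊢ N ∶ p ⇒ ∼ p ⇒ q
  N-intro {p = p} {q} P∼p Pq = ax ⟨ p , q , q ⟩ refl (P-under adm P∼p ⇛ P∼p ⇛ Pq)

  _$_ : ∀ {n} {Γ : Vector Formula n} {t u p q} →
        P ∣ Γ ⊢ t ∶ p ⇒ q → P ∣ Γ ⊢ u ∶ p → P ∣ Γ ⊢ t · u ∶ q
  d $ e = app d e (P-right adm (holds d))

  infixl 25 _$_

  K-app : ∀ {n} {Γ : Vector Formula n} {t u p q} →
          P ∣ Γ ⊢ t ∶ p → P ∣ Γ ⊢ u ∶ q → P ∣ Γ ⊢ K · t · u ∶ p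
  K-app d e = K-intro (holds d) (holds e) $ d $ e

  -- All formulas that arise are built by implication from ones that satisfy `P`, so abstraction
  -- preserves `P`.
  ƛ-intro : ∀ {n} {Γ : Vector Formula n} t {p q} → P p →
            P ∣ p ▹ Γ ⊢ t ∶ q → P ∣ Γ ⊢ ƛ t ∶ p ⇒ q
  ƛ-intro (ax h) Pp (ax σ e Pq) = K-intro Pq Pp $ ax σ e Pq
  ƛ-intro (ref zero) Pp (ref refl _) =
    S-intro Pp (Pp ⇛ Pp) Pp $ K-intro Pp (Pp ⇛ Pp) $ K-intro Pp Pp
  ƛ-intro (ref (suc i)) Pp (ref e Pq) = K-intro Pq Pp $ ref e Pq
  ƛ-intro (t · u) Pp (app d e Pq) =
    S-intro Pp (holds e) Pq $ ƛ-intro t Pp d $ ƛ-intro u Pp e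

ƛ-elim : ∀ {n} {Γ : Vector Formula n} t {r} → U ∣ Γ ⊢ ƛ t ∶ r →
         ∃ λ p → ∃ λ q → r ≡ p ⇒ q × U ∣ p ▹ Γ ⊢ t ∶ q
ƛ-elim (ax h) (app (ax σ refl _) (ax τ e _) _) = σ 1 , σ 0 , refl , ax τ e tt
-- Matching the instance `τ` of H1 with the first antecedent of H2 makes both `σ 0` and `σ 2` equal
-- to `τ 0`.
ƛ-elim (ref zero) (app (app (ax σ refl _) (ax τ e _) _) _ _) =
  σ 0 , σ 2 , refl , ref (trans (proj₂ (⇒-injective (proj₂ (⇒-injective e)))) (sym (proj₁ (⇒-injective e)))) tt
ƛ-elim (ref (suc i)) (app (ax σ refl _) (ref e _) _) = σ 1 , σ 0 , refl , ref e tt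
ƛ-elim (t · u) (app (app (ax σ refl _) d _) e _)
  with ƛ-elim t d | ƛ-elim u e
... | _ , _ , eq₁ , d′ | _ , _ , eq₂ , e′
  with ⇒-injective eq₁ | ⇒-injective eq₂
... | refl , refl | refl , refl = σ 0 , σ 2 , refl , app d′ e′ tt

ƛ-elim-⇒ : ∀ {n} {Γ : Vector Formula n} t {p q} → U ∣ Γ ⊢ ƛ t ∶ p ⇒ q → U ∣ p ▹ Γ ⊢ t ∶ q
ƛ-elim-⇒ t d with ƛ-elim t d
... | _ , _ , refl , d′ = d′

K-app-elim : ∀ {n} {Γ : Vector Formula n} {t u p} → U ∣ Γ ⊢ K · t · u ∶ p →
             U ∣ Γ ⊢ t ∶ p × ∃ λ q → U ∣ Γ ⊢ u ∶ q
K-app-elim (app (app (ax σ refl _) d _) e _) = d , σ 1 , e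

-- Combinators with a prescribed principal type

domain : Formula → Formula
domain (p ⇒ _) = p
domain p       = p

shift : ∀ {n} → (ℕ → Fin n) → ℕ → Fin (suc (suc n))
shift v x = suc (suc (v x))

-- tester b v has, as the domain of its type, the instance of b in which x is
-- replaced by the domain of the type of v x.
mutual
  tester : ∀ {n} → Formula → (ℕ → Fin n) → Term n
  tester (var x) v = ref (v x)
  tester (p ⇒ q) v = ƛ (ƛ (⇒-test p q (shift v)))
  tester (∼ p)   v = ƛ (ƛ (∼-test p (shift v)))

  -- With f the outer and a the inner abstracted variable, a is tested against `p` and f a against
  -- `q`, which forces f to have type `p ⇒ q` up to instance. `K` merely keeps both tests inside one
  -- typable term.
  ⇒-test : ∀ {n} → Formula → Formula → (ℕ → Fin (suc (suc n))) → Term (suc (suc n))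
  ⇒-test p q v = K · (tester p v · ref zero) · (tester q v · (ref (suc zero) · ref zero))

  -- H4 applied to the inner variable accepts the outer one only if the type of the outer is the
  -- negation of the type of the inner.
  ∼-test : ∀ {n} → Formula → (ℕ → Fin (suc (suc n))) → Term (suc (suc n))
  ∼-test p v = K · (tester p v · ref zero) · (N · ref zero · ref (suc zero))

tester-elim : ∀ {n} {Γ : Vector Formula n} b v {p q} →
              U ∣ Γ ⊢ tester b v ∶ p ⇒ q → p ≡ b [ (λ x → domain (Γ (v x))) ]
tester-elim (var x) v (ref e _) = cong domain e
tester-elim (b ⇒ c) v d with ƛ-elim (⇒-test b c (shift v)) (ƛ-elim-⇒ (ƛ (⇒-test b c (shift v))) d)
... | r , _ , refl , d₁ with K-app-elim d₁
... | app t (ref refl _) _ , _ , app t′ (app (ref refl _) (ref refl _) _) _ =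
  cong₂ _⇒_ (tester-elim b (shift v) t) (tester-elim c (shift v) t′)
tester-elim (∼ b) v d with ƛ-elim (∼-test b (shift v)) (ƛ-elim-⇒ (ƛ (∼-test b (shift v))) d)
... | r , _ , refl , d₁ with K-app-elim d₁
... | app t (ref refl _) _ , _ , app (app (ax σ refl _) (ref e _) _) (ref refl _) _ =
  cong ∼_ (trans e (tester-elim b (shift v) t))

bind : ∀ {n} → ℕ → (ℕ → Fin n) → ℕ → Fin (suc n)
bind x v y with x ≟ y
... | yes _ = zero
... | no _  = suc (v y)

-- One abstracted variable serves all occurrences of `x` in `b`, so these receive the same instance.
-- A repeated `x` in the list shadows the earlier one.
constraint : ∀ {n} → Formula → List ℕ → Fin n → (ℕ → Fin n) → Term n
constraint b []       i v = tester b v · ref i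
constraint b (x ∷ xs) i v = ƛ (constraint b xs (suc i) (bind x v))

constraint-elim : ∀ {n} {Γ : Vector Formula n} b xs i v {p} →
                  U ∣ Γ ⊢ constraint b xs i v ∶ p → ∃ λ θ → Γ i ≡ b [ θ ]
constraint-elim b [] i v (app d (ref refl _) _) = _ , tester-elim b v d
constraint-elim b (x ∷ xs) i v d with ƛ-elim (constraint b xs (suc i) (bind x v)) d
... | _ , _ , _ , d′ = constraint-elim b xs (suc i) (bind x v) d′

vars : Formula → List ℕ
vars (var x) = x ∷ []
vars (p ⇒ q) = vars p ++ vars q
vars (∼ p)   = vars p

occursIn⇒∈vars : ∀ {x p} → x occursIn p → x ∈ vars p
occursIn⇒∈vars here                  = here refl
occursIn⇒∈vars (left o)              = ∈-++⁺ˡ (occursIn⇒∈vars o)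
occursIn⇒∈vars {p = p ⇒ _} (right o) = ∈-++⁺ʳ (vars p) (occursIn⇒∈vars o)
occursIn⇒∈vars (under o)             = occursIn⇒∈vars o

guarded : ∀ {n} → Formula → Term (suc n)
-- `const zero` is a placeholder: every variable of `b` is rebound by `constraint`.
guarded b = K · ref zero · constraint b (vars b) zero (const zero)

ident : ∀ {n} → Formula → Term n
ident b = ƛ (guarded b)

ident-elim : ∀ {n} {Γ : Vector Formula n} b {p q} → U ∣ Γ ⊢ ident b ∶ p ⇒ q →
             ∃ λ θ → q ≡ b [ θ ]
ident-elim b d with K-app-elim (ƛ-elim-⇒ (guarded b) d)
... | ref refl _ , _ , e = constraint-elim b (vars b) zero (const zero) e

ident-app-elim : ∀ {n} {Γ : Vector Formula n} {t} b {q} → U ∣ Γ ⊢ ident b · t ∶ q →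
                 ∃ λ θ → q ≡ b [ θ ]
ident-app-elim b (app d _ _) = ident-elim b d

module _ {P : Pred Formula 0ℓ} (adm : Admissible P) where

  -- Only subformulas of `b`, variables and implications between such formulas are used, so `P`
  -- holds throughout. The codomain `q` is left open because only the domain carries the test.
  tester-intro : ∀ {n} {Γ : Vector Formula n} b v → P b →
                 (∀ x → x occursIn b → Γ (v x) ≡ var x ⇒ var x) →
                 ∃ λ q → P ∣ Γ ⊢ tester b v ∶ b ⇒ q
  tester-intro (var x) v _ vs =
    var x , ref (sym (vs x here)) (P-⇒ adm (P-var adm x) (P-var adm x))
  tester-intro {Γ = Γ} (b ⇒ c) v P⇒ vs
    with tester-intro {Γ = b ▹ (b ⇒ c) ▹ Γ} b (shift v) (P-left adm P⇒) (λ x o → vs x (left o))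
       | tester-intro {Γ = b ▹ (b ⇒ c) ▹ Γ} c (shift v) (P-right adm P⇒) (λ x o → vs x (right o))
  ... | q , d | _ , e = b ⇒ q ,
    ƛ-intro adm (ƛ (⇒-test b c (shift v))) P⇒ (ƛ-intro adm (⇒-test b c (shift v)) Pb
      (K-app adm (d ∙ ref refl Pb) (e ∙ (ref refl P⇒ ∙ ref refl Pb))))
    where
    Pb = P-left adm P⇒
    _∙_ = _$_ adm
  tester-intro {Γ = Γ} (∼ b) v P∼ vs
    with tester-intro {Γ = b ▹ ∼ b ▹ Γ} b (shift v) (P-under adm P∼) (λ x o → vs x (under o))
  ... | q , d = b ⇒ q ,
    ƛ-intro adm (ƛ (∼-test b (shift v))) P∼ (ƛ-intro adm (∼-test b (shift v)) Pb
      -- The consequent of H4 may be any formula here; a variable is chosen because it satisfies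
      -- `P`.
      (K-app adm (d ∙ ref refl Pb) ((N-intro adm P∼ (P-var adm 0) ∙ ref refl Pb) ∙ ref refl P∼)))
    where
    Pb = P-under adm P∼
    _∙_ = _$_ adm

  -- The invariant: each variable of `b` is either still waiting in `xs` or already bound at type
  -- `var x ⇒ var x`.
  constraint-intro : ∀ {n} {Γ : Vector Formula n} b xs i v → P b → Γ i ≡ b →
                     (∀ x → x occursIn b → x ∈ xs ⊎ Γ (v x) ≡ var x ⇒ var x) →
                     ∃ λ q → P ∣ Γ ⊢ constraint b xs i v ∶ q
  constraint-intro {Γ = Γ} b [] i v Pb e vs with tester-intro b v Pb bound
    where
    bound : ∀ x → x occursIn b → Γ (v x) ≡ var x ⇒ var x
    bound x o with vs x o
    ... | inj₂ eq = eq
  ... | q , d = q , _$_ adm d (ref (sym e) Pb)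
  constraint-intro {Γ = Γ} b (x ∷ xs) i v Pb e vs
    with constraint-intro {Γ = (var x ⇒ var x) ▹ Γ} b xs (suc i) (bind x v) Pb e bound
    where
    bound : ∀ y → y occursIn b → y ∈ xs ⊎ ((var x ⇒ var x) ▹ Γ) (bind x v y) ≡ var y ⇒ var y
    bound y o with x ≟ y | vs y o
    ... | yes refl | _                = inj₂ refl
    ... | no x≢y   | inj₁ (here refl) = ⊥-elim (x≢y refl)
    ... | no _     | inj₁ (there y∈)  = inj₁ y∈
    ... | no _     | inj₂ eq          = inj₂ eq
  ... | q , d = _ , ƛ-intro adm (constraint b xs (suc i) (bind x v)) (P-⇒ adm (P-var adm x) (P-var adm x)) d

  ident-intro : ∀ {n} {Γ : Vector Formula n} b → P b → P ∣ Γ ⊢ ident b ∶ b ⇒ b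
  ident-intro {Γ = Γ} b Pb
    with constraint-intro {Γ = b ▹ Γ} b (vars b) zero (const zero) Pb refl
           (λ _ o → inj₁ (occursIn⇒∈vars o))
  ... | _ , d = ƛ-intro adm (guarded b) Pb (K-app adm (ref refl Pb) d)

  -- The principal type of `ident b · t` is an instance of `b`, and `b` is an instance of it, so the
  -- two are alphabetic variants.
  typing⇒CDProof : ∀ {t b} → P ∣ ∅ ⊢ t ∶ b → Σ (CDProof H b) (StepsSatisfy P)
  typing⇒CDProof {t} {b} d = fromPrincipal (principal adm u)
    where
    u : P ∣ ∅ ⊢ ident b · t ∶ b
    u = _$_ adm (ident-intro b (holds d)) d

    fromPrincipal : Principal P (ident b · t) → Σ (CDProof H b) (StepsSatisfy P)
    fromPrincipal pt with general pt (forget u) | ident-app-elim b (typed pt)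
    ... | σ , e | τ , e′ = CDProof-≅ (proof pt) (steps pt) (instances⇒≅ σ τ e e′) (holds d)

-- Translations between proofs and typings

MPProof⇒typing : ∀ {P b} (d : MPProof H b) → All P (lines d) → ∃ λ t → P ∣ ∅ ⊢ t ∶ b
MPProof⇒typing (instanceOf h σ) (Pb ∷ []) = ax h , ax σ refl Pb
MPProof⇒typing (mp d e) (Pb ∷ ps)
  with MPProof⇒typing d (++⁻ˡ (lines d) ps) | MPProof⇒typing e (++⁻ʳ (lines d) ps)
... | t , d′ | u , e′ = t · u , app d′ e′ Pb

-- The substitution rule leaves the combinator unchanged and acts on its typing alone.
MPSubstProof⇒typing : ∀ {b} → MPSubstProof H b → ∃ λ t → ⊢ t ∶ b
MPSubstProof⇒typing (axiom {p} h) = ax h , ax var (sym ([]-var p)) tt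
MPSubstProof⇒typing (mp d e) with MPSubstProof⇒typing d | MPSubstProof⇒typing e
... | t , d′ | u , e′ = t · u , app d′ e′ tt
MPSubstProof⇒typing (subst σ d) with MPSubstProof⇒typing d
... | t , d′ = t , ⊢-[] σ d′

MPSubstProof-≅ : ∀ {p q} → p ≅ q → MPSubstProof H p → MPSubstProof H q
MPSubstProof-≅ (ρ , _ , refl) d = subst (rename ρ) d

CDProof⇒MPSubstProof : ∀ {b} → CDProof H b → MPSubstProof H b
CDProof⇒MPSubstProof (axiom h e) = MPSubstProof-≅ e (axiom h)
CDProof⇒MPSubstProof (detach d e (cd {A} {B} {C} σ M m _ (unif , _) c)) =
  MPSubstProof-≅ c (mp (subst σ (MPSubstProof-≅ M (CDProof⇒MPSubstProof d)))
    (≡-subst (MPSubstProof H) (sym unif) (subst σ (MPSubstProof-≅ m (CDProof⇒MPSubstProof e)))))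

theorem7 : (∀ b → CDProof H b ⇔ MPSubstProof H b)
    × (∀ b → (d : MPProof H b) → All (λ p → ¬ ContainsDN p) (lines d) →
    Σ (CDProof H b) DNFree)
theorem7 =
  -- The same construction serves both halves, first with the trivial predicate and then with
  -- freedom from double negations.
  (λ b → mk⇔ CDProof⇒MPSubstProof
               (λ d → proj₁ (typing⇒CDProof U-admissible (proj₂ (MPSubstProof⇒typing d))))) ,
  (λ b d free → typing⇒CDProof DN-free-admissible (proj₂ (MPProof⇒typing d free)))
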